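{- Let $n\in\mathbb{N}$ and $\mathbf{y}\in\mathbb{N}^n$. Then $\mathsf{PA}^{\mathrm{inv},\uparrow}_n(\mathbf{y})\subseteq\{1\}^{n-\chi(\mathbf{y})}\times\mathcal{W}(\mathbf{y})^{\chi(\mathbf{y})}$. In particular, $$|\mathsf{PA}^{\mathrm{inv},\uparrow}_n(\mathbf{y})|\le\binom{2^{n-1}+n-2}{n-1}.$$
   Context: $\mathbb{N}=\{1,2,3,\dots\}$ and $[n]=\{1,\dots,n\}$. Let $\mathbf{y}=(y_1,\dots,y_n)\in\mathbb{N}^n$ and $m=\sum_{i=1}^n y_i$. Consider a one-way street with $m$ parking spots numbered $1,\dots,m$ and $n$ cars entering in order $1,2,\dots,n$, where car $i$ has length $y_i$ and prefers spot $x_i\in[m]$. Car $i$ drives to spot $x_i$ and parks in $x_i,x_i+1,\dots,x_i+y_i-1$ if these spots exist and are all unoccupied; otherwise it parks in the next $y_i$ contiguous available spots, i.e. it occupies $s,s+1,\dots,s+y_i-1$ for the smallest $s\ge x_i$ such that $s+y_i-1\le m$ and all these spots are unoccupied; if no such $s$ exists, parking fails. The vector $\mathbf{x}=(x_1,\dots,x_n)\in[m]^n$ is a parking assortment for $\mathbf{y}$ if all cars can park; the set of these is $\mathsf{PA}_n(\mathbf{y})$. A parking assortment $\mathbf{x}$ is (permutation) invariant if every permutation of its entries is also in $\mathsf{PA}_n(\mathbf{y})$; $\mathsf{PA}^{\mathrm{inv}}_n(\mathbf{y})$ is the set of invariant parking assortments for $\mathbf{y}$, and $\mathsf{PA}^{\mathrm{inv},\uparrow}_n(\mathbf{y})\subseteq\mathsf{PA}^{\mathrm{inv}}_n(\mathbf{y})$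 is its subset of nondecreasing elements. For $\mathbf{x}\in\mathsf{PA}^{\mathrm{inv}}_n(\mathbf{y})$ the degree is $\deg\mathbf{x}=|\{i\in[n]:x_i\ne 1\}|$, and the characteristic of $\mathbf{y}$ is $\chi(\mathbf{y})=\max_{\mathbf{z}\in\mathsf{PA}^{\mathrm{inv}}_n(\mathbf{y})}\deg\mathbf{z}$. The invariant solution set of $\mathbf{y}$ is $\mathcal{W}(\mathbf{y})=\{w\in\mathbb{N}:(1^{n-1},w)\in\mathsf{PA}^{\mathrm{inv}}_n(\mathbf{y})\}$, where $(1^{n-1},w)$ is the vector $(1,\dots,1,w)$ with $n-1$ leading ones. -}

module Defs where

open import Data.List.Base as List using (List; []; _∷_; _++_; length; filter; cartesianProductWith)
open import Data.List.Extrema.Nat using (max)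
open import Data.List.Membership.Propositional using (_∈_; _∉_)
import Data.List.Membership.DecPropositional as DecMembership
open import Data.List.Membership.Propositional.Properties
  using (∈-∃++; ∈-map⁺; ∈-map⁻; ∈-upTo⁺; ∈-upTo⁻; ∈-cartesianProductWith⁺;
         ∈-cartesianProductWith⁻; ∈-filter⁺; ∈-filter⁻)
open import Data.List.Relation.Binary.Permutation.Propositional
  using (_↭_; ↭-refl; ↭-sym; ↭-trans; prep)
open import Data.List.Relation.Binary.Permutation.Propositional.Properties
  using (∈-resp-↭; drop-mid; shift; ¬x∷xs↭[])
import Data.List.Relation.Unary.All as ListAll
import Data.List.Relation.Unary.AllPairs as AllPairs
open import Data.List.Relation.Unary.Any using (here)
open import Data.List.Relation.Unary.Unique.Propositional using (Unique)
import Data.List.Relation.Unary.Unique.Propositional.Properties as Unique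
open import Data.Nat.Base
open import Data.Nat.Properties
  using (_≟_; _≤?_; anyUpTo?; allUpTo?; suc-injective; ≤-trans; m≤m+n)
open import Data.Product.Base using (∃; ∃-syntax; _×_; _,_; proj₁; proj₂)
open import Data.Unit.Base using (⊤; tt)
open import Data.Vec.Base as Vec using (Vec; []; _∷_; _∷ʳ_; sum; replicate; count; toList)
open import Data.Vec.Properties using (∷-injective)
open import Data.Vec.Relation.Unary.All as All using (All; []; _∷_)
open import Data.Vec.Relation.Unary.Linked using (Linked; linked?)
open import Function.Base using (_∘_)
open import Function.Bundles using (_⇔_; mk⇔)
open import Level using (0ℓ)
open import Relation.Binary.PropositionalEquality.Core using (_≡_; refl)
open import Relation.Nullary.Decidable using (Dec; yes; no; map′; _×-dec_; _→-dec_; ¬?)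
open import Relation.Nullary.Negation.Core using (¬_)
open import Relation.Unary using (Pred; Decidable)

open DecMembership _≟_ using (_∈?_)

-- The street has spots 1 , … , m; `occ` lists the spots occupied so far.

spots : ℕ → ℕ → List ℕ
spots s ℓ = List.map (s +_) (List.upTo ℓ)

-- s + ℓ ≤ suc m says s + ℓ - 1 ≤ m.

Fits : (m : ℕ) (occ : List ℕ) (ℓ s : ℕ) → Set
Fits m occ ℓ s = s + ℓ ≤ suc m × ListAll.All (_∉ occ) (spots s ℓ)

-- A car of length ℓ preferring spot x parks from spot s onwards: s is the
-- least s ≥ x that fits (in particular s = x whenever x itself fits).

ParksAt : (m : ℕ) (occ : List ℕ) (ℓ x s : ℕ) → Set
ParksAt m occ ℓ x s =
  x ≤ s × Fits m occ ℓ s × (∀ {t} → t < s → x ≤ t → ¬ Fits m occ ℓ t)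

AllPark : ∀ {n} (m : ℕ) (occ : List ℕ) (y x : Vec ℕ n) → Set
AllPark m occ []      []      = ⊤
AllPark m occ (ℓ ∷ y) (p ∷ x) =
  ∃[ s ] ParksAt m occ ℓ p s × AllPark m (spots s ℓ ++ occ) y x

InRange : ℕ → ℕ → Set
InRange m v = 1 ≤ v × v ≤ m

PA : ∀ {n} → Vec ℕ n → Pred (Vec ℕ n) 0ℓ
PA y x = All (InRange (sum y)) x × AllPark (sum y) [] y x

PAinv : ∀ {n} → Vec ℕ n → Pred (Vec ℕ n) 0ℓ
PAinv y x = PA y x × (∀ x′ → toList x′ ↭ toList x → PA y x′)

PAinv↑ : ∀ {n} → Vec ℕ n → Pred (Vec ℕ n) 0ℓ
PAinv↑ y x = PAinv y x × Linked _≤_ x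

deg : ∀ {n} → Vec ℕ n → ℕ
deg = count (λ v → ¬? (v ≟ 1))

𝓦 : ∀ {k} → Vec ℕ (suc k) → Pred ℕ 0ℓ
𝓦 {k} y w = PAinv y (replicate k 1 ∷ʳ w)

-- x ∈ {1}ᵃ × Pᵇ.

Ones×Power : ∀ {n} (a : ℕ) (P : Pred ℕ 0ℓ) (b : ℕ) → Vec ℕ n → Set
Ones×Power a P b x =
  ∃ λ (ws : Vec ℕ b) → toList x ≡ List.replicate a 1 ++ toList ws × All P ws

Fits? : ∀ m occ ℓ → Decidable (Fits m occ ℓ)
Fits? m occ ℓ s =
  (s + ℓ ≤? suc m) ×-dec ListAll.all? (λ v → ¬? (v ∈? occ)) (spots s ℓ)

ParksAt? : ∀ m occ ℓ x → Decidable (ParksAt m occ ℓ x)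
ParksAt? m occ ℓ x s =
  (x ≤? s) ×-dec Fits? m occ ℓ s ×-dec
  allUpTo? (λ t → (x ≤? t) →-dec ¬? (Fits? m occ ℓ t)) s

AllPark? : ∀ {n} m occ (y : Vec ℕ n) → Decidable (AllPark m occ y)
AllPark? m occ []      []      = yes tt
AllPark? m occ (ℓ ∷ y) (p ∷ x) = map′
  (λ (s , _ , q) → s , q)
  (λ (s , q) → s , s≤s (≤-trans (m≤m+n s ℓ) (proj₁ (proj₁ (proj₂ (proj₁ q))))) , q)
  (anyUpTo? (λ s → ParksAt? m occ ℓ p s ×-dec AllPark? m (spots s ℓ ++ occ) y x)
            (suc (suc m)))

PA? : ∀ {n} (y : Vec ℕ n) → Decidable (PA y)
PA? y x =
  All.all? (λ v → (1 ≤? v) ×-dec (v ≤? sum y)) x ×-dec AllPark? (sum y) [] y x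

_↭?_ : (xs ys : List ℕ) → Dec (xs ↭ ys)
[]       ↭? []      = yes ↭-refl
[]       ↭? (_ ∷ _) = no (¬x∷xs↭[] ∘ ↭-sym)
(x ∷ xs) ↭? ys with x ∈? ys
... | no x∉ys  = no λ p → x∉ys (∈-resp-↭ p (here refl))
... | yes x∈ys with ∈-∃++ x∈ys
...   | as , bs , refl = map′
  (λ p → ↭-trans (prep x p) (↭-sym (shift x as bs)))
  (drop-mid [] as)
  (xs ↭? (as ++ bs))

range : ℕ → List ℕ
range m = List.map suc (List.upTo m)

vectors : (m n : ℕ) → List (Vec ℕ n)
vectors m zero    = [] ∷ []
vectors m (suc n) = cartesianProductWith _∷_ (range m) (vectors m n)

∈-range⁺ : ∀ {m v} → InRange m v → v ∈ range m
∈-range⁺ {v = suc v} (_ , v<m) = ∈-map⁺ suc (∈-upTo⁺ v<m)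

∈-range⁻ : ∀ {m v} → v ∈ range m → InRange m v
∈-range⁻ v∈ with _ , i∈ , refl ← ∈-map⁻ suc v∈ = s≤s z≤n , ∈-upTo⁻ i∈

∈-vectors⁺ : ∀ {m n} {x : Vec ℕ n} → All (InRange m) x → x ∈ vectors m n
∈-vectors⁺ []       = here refl
∈-vectors⁺ (p ∷ ps) = ∈-cartesianProductWith⁺ _∷_ (∈-range⁺ p) (∈-vectors⁺ ps)

∈-vectors⁻ : ∀ {m n} {x : Vec ℕ n} → x ∈ vectors m n → All (InRange m) x
∈-vectors⁻ {n = zero}  (here refl) = []
∈-vectors⁻ {m} {suc n} x∈
  with _ , _ , v∈ , z∈ , refl ← ∈-cartesianProductWith⁻ _∷_ (range m) (vectors m n) x∈
  = ∈-range⁻ v∈ ∷ ∈-vectors⁻ z∈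

vectors-unique : ∀ m n → Unique (vectors m n)
vectors-unique m zero    = ListAll.[] AllPairs.∷ AllPairs.[]
vectors-unique m (suc n) = Unique.cartesianProductWith⁺ _∷_ ∷-injective
  (Unique.map⁺ suc-injective (Unique.upTo⁺ m)) (vectors-unique m n)

PAinv? : ∀ {n} (y : Vec ℕ n) → Decidable (PAinv y)
PAinv? {n} y x with PA? y x
... | no ¬pa = no (¬pa ∘ proj₁)
... | yes pa = map′
  (λ all → pa , λ x′ p → ListAll.lookup all (∈-vectors⁺ (range-resp p)) p)
  (λ (_ , inv) → ListAll.tabulate (λ {x′} _ → inv x′))
  (ListAll.all? (λ x′ → (toList x′ ↭? toList x) →-dec PA? y x′) (vectors (sum y) n))
  where
  toList⁺ : ∀ {k} {z : Vec ℕ k} → All (InRange (sum y)) z →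
            ListAll.All (InRange (sum y)) (toList z)
  toList⁺ []       = ListAll.[]
  toList⁺ (q ∷ qs) = q ListAll.∷ toList⁺ qs
  toList⁻ : ∀ {k} (z : Vec ℕ k) → ListAll.All (InRange (sum y)) (toList z) →
            All (InRange (sum y)) z
  toList⁻ []      _                = []
  toList⁻ (_ ∷ z) (q ListAll.∷ qs) = q ∷ toList⁻ z qs
  range-resp : {x′ : Vec ℕ n} → toList x′ ↭ toList x → All (InRange (sum y)) x′
  range-resp {x′} p = toList⁻ x′ (ListAll.tabulate
    (ListAll.lookup (toList⁺ (proj₁ pa)) ∘ ∈-resp-↭ p))

PAinv↑? : ∀ {n} (y : Vec ℕ n) → Decidable (PAinv↑ y)
PAinv↑? y x = PAinv? y x ×-dec linked? _≤?_ x

PAinv-list : ∀ {n} → Vec ℕ n → List (Vec ℕ n)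
PAinv-list {n} y = filter (PAinv? y) (vectors (sum y) n)

PAinv↑-list : ∀ {n} → Vec ℕ n → List (Vec ℕ n)
PAinv↑-list {n} y = filter (PAinv↑? y) (vectors (sum y) n)

∈-PAinv-list : ∀ {n} {y x : Vec ℕ n} → x ∈ PAinv-list y ⇔ PAinv y x
∈-PAinv-list {n} {y} = mk⇔
  (λ x∈ → proj₂ (∈-filter⁻ (PAinv? y) {xs = vectors (sum y) n} x∈))
  (λ p → ∈-filter⁺ (PAinv? y) (∈-vectors⁺ (proj₁ (proj₁ p))) p)

∈-PAinv↑-list : ∀ {n} {y x : Vec ℕ n} → x ∈ PAinv↑-list y ⇔ PAinv↑ y x
∈-PAinv↑-list {n} {y} = mk⇔
  (λ x∈ → proj₂ (∈-filter⁻ (PAinv↑? y) {xs = vectors (sum y) n} x∈))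
  (λ p → ∈-filter⁺ (PAinv↑? y) (∈-vectors⁺ (proj₁ (proj₁ (proj₁ p)))) p)

PAinv↑-list-unique : ∀ {n} (y : Vec ℕ n) → Unique (PAinv↑-list y)
PAinv↑-list-unique {n} y = Unique.filter⁺ (PAinv↑? y) (vectors-unique (sum y) n)

-- The default 0 is harmless: it is deg (1 , … , 1), and (1 , … , 1) is an
-- invariant parking assortment whenever all lengths are positive.

χ : ∀ {n} → Vec ℕ n → ℕ
χ y = max 0 (List.map deg (PAinv-list y))

∣PAinv↑_∣ : ∀ {n} → Vec ℕ n → ℕ
∣PAinv↑ y ∣ = length (PAinv↑-list y)

{-# OPTIONS --safe #-}

-- Let x be nondecreasing and invariant, and w = x_j. For every position i,
-- (1^{i-1} , w , 1^{n-i}) parks because some rearrangement r of x does: take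
-- r = x if i > j, and x with x_j moved forward to position i otherwise. The
-- cars fill the whole street, so if a preference in r is at most all later
-- ones, then every spot below it is already taken when its car arrives, and
-- lowering that preference does not change where the car parks. All entries of
-- r but the i-th can thus be lowered to 1, and the i-th one, if it is not w
-- already, to w.
--
-- For the count, if (w , 1 , … , 1) parks, then the first car parks at w and
-- the cars ending up before it have total length w - 1. So the entries of x
-- other than x_1 = 1 form a multiset of n - 1 numbers 1 + σ with σ a subset sum of
-- y_2 , … , y_n.

module Submission where

open import Defs
open import Data.List.Base as List using (List; []; _∷_; _++_; length; filter)
open import Data.List.Extrema.Nat using (max≤v⁺; xs≤max)
open import Data.List.Membership.Propositional using (_∈_)
open import Data.List.Membership.Propositional.Properties
open import Data.List.Properties
  using (∷-injective; ++-identityʳ; length-map; length-upTo; length-++; length-++-sucʳ;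
         filter-++; filter-all; filter-none)
open import Data.List.Relation.Binary.Permutation.Propositional
  using (_↭_; ↭-refl; ↭-sym; ↭-trans; ↭-reflexive; prep; swap)
open import Data.List.Relation.Binary.Permutation.Propositional.Properties
  using (∈-resp-↭; All-resp-↭; ↭-length; drop-mid)
open import Data.List.Relation.Binary.Subset.Propositional using (_⊆_)
import Data.List.Relation.Unary.All as ListAll
import Data.List.Relation.Unary.All.Properties as ListAll
import Data.List.Relation.Unary.AllPairs as ListPairs
open import Data.List.Relation.Unary.Any using (here; there)
open import Data.List.Relation.Unary.Linked.Properties using (Linked⇒AllPairs)
open import Data.List.Relation.Unary.Unique.Propositional using (Unique)
import Data.List.Relation.Unary.Unique.Propositional.Properties as Unique
open import Data.Nat.Base
open import Data.Nat.Combinatorics using (_C_; nCk+nC[k+1]≡[n+1]C[k+1]; k>n⇒nCk≡0)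
open import Data.Nat.Properties
open import Data.List.Membership.DecPropositional _≟_ using (_∈?_)
open import Data.List.Sort ≤-decTotalOrder using (sort; sort-↭; sort-↗)
open import Data.Product.Base using (∃-syntax; _×_; _,_; proj₁; proj₂)
open import Data.Sum.Base using (inj₁; inj₂; [_,_]′)
open import Data.Vec.Base using (Vec; []; _∷_; _∷ʳ_; sum; replicate; toList)
open import Data.Vec.Properties using (count≤n; lookup-replicate; toList-∷ʳ; toList-replicate)
open import Data.Vec.Relation.Unary.All as All using (All; []; _∷_)
import Data.Vec.Relation.Unary.All.Properties as All
open import Data.Vec.Relation.Unary.AllPairs using (AllPairs; []; _∷_)
open import Data.Vec.Relation.Unary.Linked using (Linked; []; [-]; _∷_)
import Data.Vec.Relation.Unary.Linked.Properties as Linked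
open import Function.Base using (_∘_)
open import Function.Bundles using (Equivalence)
open import Level using (0ℓ)
open import Relation.Binary.PropositionalEquality
open import Relation.Nullary.Decidable using (yes; no)
open import Relation.Nullary.Negation using (¬_; contradiction)
open import Relation.Unary using (Pred)

-- Lists without repetition and intervals of spots

Unique⇒length≤ : ∀ {A : Set} {xs ys : List A} → Unique xs → xs ⊆ ys → length xs ≤ length ys
Unique⇒length≤ ListPairs.[] _ = z≤n
Unique⇒length≤ {xs = x ∷ xs} (x∉xs ListPairs.∷ uniq) xs⊆ys with ∈-∃++ (xs⊆ys (here refl))
... | as , bs , refl = ≤-trans (s≤s (Unique⇒length≤ uniq xs⊆))
                               (≤-reflexive (sym (length-++-sucʳ as x bs)))
  where
  xs⊆ : xs ⊆ as ++ bs
  xs⊆ v∈ with ∈-++⁻ as (xs⊆ys (there v∈))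
  ... | inj₁ v∈as         = ∈-++⁺ˡ v∈as
  ... | inj₂ (here refl)  = contradiction refl (ListAll.lookup x∉xs v∈)
  ... | inj₂ (there v∈bs) = ∈-++⁺ʳ as v∈bs

length-range : ∀ m → length (range m) ≡ m
length-range m = trans (length-map suc (List.upTo m)) (length-upTo m)

range-unique : ∀ m → Unique (range m)
range-unique m = Unique.map⁺ suc-injective (Unique.upTo⁺ m)

length-spots : ∀ s ℓ → length (spots s ℓ) ≡ ℓ
length-spots s ℓ = trans (length-map (s +_) (List.upTo ℓ)) (length-upTo ℓ)

∈-spots⁻ : ∀ s ℓ {t} → t ∈ spots s ℓ → s ≤ t × t < s + ℓ
∈-spots⁻ s ℓ t∈ with i , i∈ , refl ← ∈-map⁻ (s +_) t∈ =
  m≤m+n s i , +-monoʳ-< s (∈-upTo⁻ i∈)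

∈-spots⁺ : ∀ s ℓ {t} → s ≤ t → t < s + ℓ → t ∈ spots s ℓ
∈-spots⁺ s ℓ s≤t t<s+ℓ with i , refl ← m≤n⇒∃[o]m+o≡n s≤t =
  ∈-map⁺ (s +_) (∈-upTo⁺ (+-cancelˡ-< s i ℓ t<s+ℓ))

start∈spots : ∀ s {ℓ} → 1 ≤ ℓ → s ∈ spots s ℓ
start∈spots s {ℓ} 1≤ℓ = ∈-spots⁺ s ℓ ≤-refl (m<m+n s 1≤ℓ)

-- Cars that fill the street exactly

-- `r` stands for the total length of the cars still to come, so once none remain the occupied spots
-- number exactly `m`.
record Packed (m : ℕ) (occ : List ℕ) (r : ℕ) : Set where
  field
    unique  : Unique occ
    inRange : ListAll.All (InRange m) occ
    total   : length occ + r ≡ m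

open Packed

Packed-[] : ∀ {m} → Packed m [] m
Packed-[] = record { unique = ListPairs.[] ; inRange = ListAll.[] ; total = refl }

Packed-park : ∀ {m occ ℓ s r} → Packed m occ (ℓ + r) → 1 ≤ s → Fits m occ ℓ s →
              Packed m (spots s ℓ ++ occ) r
Packed-park {m} {occ} {ℓ} {s} {r} pk 1≤s (s+ℓ≤ , free) = record
  { unique  = Unique.++⁺ (Unique.map⁺ (+-cancelˡ-≡ s _ _) (Unique.upTo⁺ ℓ)) (unique pk)
                (λ (t∈ , t∈occ) → ListAll.lookup free t∈ t∈occ)
  ; inRange = ListAll.++⁺ (ListAll.tabulate λ t∈ → let s≤t , t<s+ℓ = ∈-spots⁻ s ℓ t∈ in
                ≤-trans 1≤s s≤t , s≤s⁻¹ (≤-trans t<s+ℓ s+ℓ≤)) (inRange pk)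
  ; total   = begin
      length (spots s ℓ ++ occ) + r        ≡⟨ cong (_+ r) (length-++ (spots s ℓ)) ⟩
      length (spots s ℓ) + length occ + r  ≡⟨ cong (λ a → a + length occ + r) (length-spots s ℓ) ⟩
      ℓ + length occ + r                   ≡⟨ cong (_+ r) (+-comm ℓ (length occ)) ⟩
      length occ + ℓ + r                   ≡⟨ +-assoc (length occ) ℓ r ⟩
      length occ + (ℓ + r)                 ≡⟨ total pk ⟩
      m                                    ∎
  }
  where open ≡-Reasoning

-- Pigeonhole: otherwise `t ∷ occ` would hold m + 1 distinct numbers among 1, ..., m.
Packed-full : ∀ {m occ t} → Packed m occ 0 → InRange m t → t ∈ occ
Packed-full {m} {occ} {t} pk t-ok with t ∈? occ
... | yes t∈ = t∈
... | no  t∉ = contradiction too-long (n≮n m)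
  where
  ⊆-range : t ∷ occ ⊆ range m
  ⊆-range (here refl) = ∈-range⁺ t-ok
  ⊆-range (there v∈)  = ∈-range⁺ (ListAll.lookup (inRange pk) v∈)

  too-long : m < m
  too-long = begin
    suc m              ≡⟨ cong suc (trans (sym (+-identityʳ (length occ))) (total pk)) ⟨
    length (t ∷ occ)   ≤⟨ Unique⇒length≤ (ListAll.¬Any⇒All¬ occ t∉ ListPairs.∷ unique pk) ⊆-range ⟩
    length (range m)   ≡⟨ length-range m ⟩
    m                  ∎
    where open ≤-Reasoning

-- Lowering preferences

-- The remaining cars all start at `p` or later and so cannot cover `t`, yet after them the street
-- is full.
AllPark-occupied : ∀ {n m occ p} {y x : Vec ℕ n} → AllPark m occ y x → Packed m occ (sum y) →
                   1 ≤ p → All (p ≤_) x → ∀ {t} → InRange m t → t < p → t ∈ occ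
AllPark-occupied {y = []} {[]} _ pk _ _ t-ok _ = Packed-full pk t-ok
AllPark-occupied {y = ℓ ∷ y} {_ ∷ x} (s , (x≤s , fits , _) , park) pk 1≤p (p≤x ∷ p≤xs) t-ok t<p
  with ∈-++⁻ (spots s ℓ)
         (AllPark-occupied park (Packed-park pk (≤-trans 1≤p p≤s) fits) 1≤p p≤xs t-ok t<p)
  where p≤s = ≤-trans p≤x x≤s
... | inj₂ t∈occ = t∈occ
... | inj₁ t∈    = contradiction (<-≤-trans t<p (≤-trans p≤x x≤s)) (≤⇒≯ (proj₁ (∈-spots⁻ s ℓ t∈)))

-- A car of positive length covers the spot it starts from, so the taken spots from `q` up to `p`
-- offer no earlier start.
ParksAt-lower : ∀ {m occ ℓ p q s} → 1 ≤ ℓ → q ≤ p → (∀ {t} → q ≤ t → t < p → t ∈ occ) →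
                ParksAt m occ ℓ p s → ParksAt m occ ℓ q s
ParksAt-lower {m} {occ} {ℓ} {p} {q} {s} 1≤ℓ q≤p taken (p≤s , fits , least) =
  ≤-trans q≤p p≤s , fits , least′
  where
  least′ : ∀ {t} → t < s → q ≤ t → ¬ Fits m occ ℓ t
  least′ {t} t<s q≤t fits′ with p ≤? t
  ... | yes p≤t = least t<s p≤t fits′
  ... | no  p≰t = ListAll.lookup (proj₂ fits′) (start∈spots t 1≤ℓ) (taken q≤t (≰⇒> p≰t))

infix 4 _≼_

-- `lower` compares `p` with the later entries of `r`, not of `z`, because `AllPark-occupied` is
-- applied to the parking of `r`.
data _≼_ : ∀ {n} → Vec ℕ n → Vec ℕ n → Set where
  []    : [] ≼ []
  keep  : ∀ {n p} {z r : Vec ℕ n} → z ≼ r → p ∷ z ≼ p ∷ r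
  lower : ∀ {n p q} {z r : Vec ℕ n} → 1 ≤ q → q ≤ p → All (p ≤_) r → z ≼ r → q ∷ z ≼ p ∷ r

-- Each car parks in the same spots under `z` as under `r`, so both runs share one `occ` and the
-- witnesses `s` carry over.
AllPark-≼ : ∀ {n m occ} {y z r : Vec ℕ n} → z ≼ r → All (1 ≤_) y → All (1 ≤_) r →
            Packed m occ (sum y) → AllPark m occ y r → AllPark m occ y z
AllPark-≼ {y = []} [] _ _ _ _ = _
AllPark-≼ {y = _ ∷ _} (keep z≼r) (_ ∷ 1≤y) (1≤p ∷ 1≤r) pk (s , at@(p≤s , fits , _) , park) =
  s , at , AllPark-≼ z≼r 1≤y 1≤r (Packed-park pk (≤-trans 1≤p p≤s) fits) park
AllPark-≼ {m = m} {occ} {y = ℓ ∷ _} (lower {p = p} {q} 1≤q q≤p p≤r z≼r) (1≤ℓ ∷ 1≤y) (1≤p ∷ 1≤r) pk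
  parks@(s , at@(p≤s , fits@(s+ℓ≤ , _) , _) , park) =
  s , ParksAt-lower 1≤ℓ q≤p taken at ,
  AllPark-≼ z≼r 1≤y 1≤r (Packed-park pk (≤-trans 1≤p p≤s) fits) park
  where
  taken : ∀ {t} → q ≤ t → t < p → t ∈ occ
  taken q≤t t<p = AllPark-occupied parks pk 1≤p (≤-refl ∷ p≤r)
    (≤-trans 1≤q q≤t , s≤s⁻¹ (≤-trans (<-≤-trans t<p p≤s) (≤-trans (m≤m+n s ℓ) s+ℓ≤))) t<p

-- Nondecreasing vectors and their rearrangements

Sorted : ∀ {n} → Vec ℕ n → Set
Sorted = AllPairs _≤_

Linked⇒Sorted : ∀ {n} {x : Vec ℕ n} → Linked _≤_ x → Sorted x
Linked⇒Sorted []        = []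
Linked⇒Sorted [-]       = [] ∷ []
Linked⇒Sorted (p≤ ∷ xs) = Linked.Linked⇒All ≤-trans p≤ xs ∷ Linked⇒Sorted xs

All-resp-toList↭ : ∀ {n k} {P : Pred ℕ 0ℓ} {x : Vec ℕ n} {z : Vec ℕ k} →
                   toList x ↭ toList z → All P x → All P z
All-resp-toList↭ p = All.toList⁻ ∘ All-resp-↭ p ∘ All.toList⁺

-- In a nondecreasing vector every entry is at most all later ones, so each of them may be lowered.
Sorted-≼ : ∀ {n} {x z : Vec ℕ n} → Sorted x → All (λ q → 1 ≤ q × All (q ≤_) x) z → z ≼ x
Sorted-≼ []          []                       = []
Sorted-≼ (p≤x ∷ sorted) ((1≤q , q≤p ∷ _) ∷ qs) =
  lower 1≤q q≤p p≤x (Sorted-≼ sorted (All.map (λ (1≤q , q≤) → 1≤q , All.tail q≤) qs))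

Sorted-extract : ∀ {n w} {x : Vec ℕ (suc n)} → Sorted x → w ∈ toList x →
                 ∃[ r ] toList {n = suc n} (w ∷ r) ↭ toList x × Sorted r
Sorted-extract {x = _ ∷ x} (_ ∷ sorted) (here refl) = x , ↭-refl , sorted
Sorted-extract {w = w} {x = p ∷ _ ∷ _} (p≤x ∷ sorted) (there w∈)
  with r , r↭ , r-sorted ← Sorted-extract sorted w∈ =
  p ∷ r , ↭-trans (swap w p ↭-refl) (prep p r↭) ,
  All.tail (All-resp-toList↭ (↭-sym r↭) p≤x) ∷ r-sorted

-- Vectors of ones with one distinguished entry

-- The constructors record where `w` stands, so that proofs can recurse on its position; `w` may
-- itself be 1.
data OnesBut (w : ℕ) : ∀ {n} → Vec ℕ n → Set where
  this : ∀ {n} {z : Vec ℕ n} → All (_≡ 1) z → OnesBut w (w ∷ z)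
  one  : ∀ {n} {z : Vec ℕ n} → OnesBut w z → OnesBut w (1 ∷ z)

OnesBut⇒All : ∀ {n w} {P : Pred ℕ 0ℓ} {z : Vec ℕ n} → P 1 → P w → OnesBut w z → All P z
OnesBut⇒All {P = P} p1 pw (this ones) = pw ∷ All.map (λ { refl → p1 }) ones
OnesBut⇒All p1 pw (one z)     = p1 ∷ OnesBut⇒All p1 pw z

-- Cancelling one `w` on each side leaves a rearrangement of ones, hence only ones.
↭⇒OnesBut : ∀ {k w} (z : Vec ℕ (suc k)) → toList z ↭ toList (replicate k 1 ∷ʳ w) → OnesBut w z
↭⇒OnesBut {k} {w} z p = split (∈-∃++ (∈-resp-↭ (↭-sym z↭) (∈-++⁺ʳ (toList 1ᵏ) (here refl))))
  where
  1ᵏ : Vec ℕ k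
  1ᵏ = replicate k 1

  z↭ : toList z ↭ toList 1ᵏ ++ w ∷ []
  z↭ = ↭-trans p (↭-reflexive (toList-∷ʳ w 1ᵏ))

  build : ∀ {n} (z : Vec ℕ n) as {bs} → toList z ≡ as ++ w ∷ bs →
          ListAll.All (_≡ 1) (as ++ bs) → OnesBut w z
  build (_ ∷ z) []       refl ones                    = this (All.toList⁻ ones)
  build (_ ∷ z) (_ ∷ as) eq   (refl ListAll.∷ ones)
    with refl , eq′ ← ∷-injective eq = one (build z as eq′ ones)

  split : (∃[ as ] ∃[ bs ] toList z ≡ as ++ w ∷ bs) → OnesBut w z
  split (as , bs , eq) = build z as eq
    (All-resp-↭ (↭-sym (drop-mid as (toList 1ᵏ) (subst (_↭ _) eq z↭)))
      (subst (ListAll.All (_≡ 1))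
        (sym (trans (++-identityʳ (toList 1ᵏ)) (toList-replicate k 1)))
        (ListAll.replicate⁺ k refl)))

-- The recursion walks along `x` and `z` together until one of them reaches its `w`.
OnesBut-≼ : ∀ {n w} {x z : Vec ℕ n} → Sorted x → All (1 ≤_) x → w ∈ toList x → OnesBut w z →
            ∃[ r ] toList {n = n} r ↭ toList x × z ≼ r
-- `z` has reached `w`: the `w` of `x` is moved up to this place and kept, and the other entries,
-- still nondecreasing, are lowered to 1.
OnesBut-≼ {x = x@(_ ∷ _)} sorted 1≤x w∈ (this ones)
  with r , r↭ , r-sorted ← Sorted-extract sorted w∈ =
  _ , r↭ , keep (Sorted-≼ r-sorted
    (All.map (λ { refl → ≤-refl , All.tail (All-resp-toList↭ (↭-sym r↭) 1≤x) }) ones))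
-- `x` reaches `w` first: all its entries from here on are at least `w`, so they can be lowered to 1
-- or `w` without rearranging.
OnesBut-≼ {x = x} (w≤x ∷ sorted) (1≤w ∷ 1≤x) (here refl) (one z) =
  x , ↭-refl , lower ≤-refl 1≤w w≤x (Sorted-≼ sorted (OnesBut⇒All (≤-refl , 1≤x) (1≤w , w≤x) z))
-- Rearranging the tail keeps `p` at most all later entries, so it can be lowered to 1.
OnesBut-≼ {x = p ∷ _} (p≤x ∷ sorted) (1≤p ∷ 1≤x) (there w∈) (one z)
  with r , r↭ , z≼r ← OnesBut-≼ sorted 1≤x w∈ z =
  p ∷ r , prep p r↭ , lower ≤-refl 1≤p (All-resp-toList↭ (↭-sym r↭) p≤x) z≼r

-- Entries lie in the invariant solution set

module _ {k} {y : Vec ℕ (suc k)} (1≤y : All (1 ≤_) y) where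

  OnesBut⇒PA : ∀ {x w z} → PAinv↑ y x → w ∈ toList x → OnesBut w z → PA y z
  OnesBut⇒PA {x} {w} {z} (((x-ok , _) , inv) , linked) w∈ z-ones
    with r , r↭ , z≼r ← OnesBut-≼ (Linked⇒Sorted linked) (All.map proj₁ x-ok) w∈ z-ones =
    OnesBut⇒All (≤-refl , 1≤sum 1≤y) (ListAll.lookup (All.toList⁺ x-ok) w∈) z-ones ,
    AllPark-≼ z≼r 1≤y (All-resp-toList↭ (↭-sym r↭) (All.map proj₁ x-ok)) Packed-[]
      (proj₂ (inv r r↭))
    where
    1≤sum : {y : Vec ℕ (suc k)} → All (1 ≤_) y → 1 ≤ sum y
    1≤sum {ℓ ∷ y} (1≤ℓ ∷ _) = ≤-trans 1≤ℓ (m≤m+n ℓ (sum y))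

  entries∈𝓦 : ∀ {x} → PAinv↑ y x → All (𝓦 y) x
  entries∈𝓦 {x} px = All.toList⁻ (ListAll.tabulate λ {w} w∈ →
    OnesBut⇒PA px w∈ (↭⇒OnesBut _ ↭-refl) , λ z p → OnesBut⇒PA px w∈ (↭⇒OnesBut z p))

-- Degree and characteristic

deg≡n : ∀ {n} {x : Vec ℕ n} → All (1 <_) x → deg x ≡ n
deg≡n []                        = refl
deg≡n (s≤s (s≤s z≤n) ∷ 1<x) = cong suc (deg≡n 1<x)

-- A head other than 1 makes every entry exceed 1, by the order; the degree is then the full length
-- `suc a + b`, more than `b`.
Sorted⇒Ones×Power : ∀ {n} a {b} {P : Pred ℕ 0ℓ} {x : Vec ℕ n} → n ≡ a + b → Sorted x →
                    All (1 ≤_) x → All P x → deg x ≤ b → Ones×Power a P b x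
Sorted⇒Ones×Power zero {x = x} refl _ _ px _ = x , refl , px
Sorted⇒Ones×Power (suc a) {b} {x = p ∷ _} refl (p≤x ∷ sorted) (1≤p ∷ 1≤x) (_ ∷ px) deg≤ with p ≟ 1
... | yes refl with ws , eq , pws ← Sorted⇒Ones×Power a refl sorted 1≤x px deg≤ =
        ws , cong (1 ∷_) eq , pws
... | no p≢1 = contradiction (≤-trans (≤-reflexive (sym (deg≡n (1<p ∷ All.map (<-≤-trans 1<p) p≤x)))) deg≤)
                             (<⇒≱ (s≤s (m≤n+m b a)))
  where 1<p = ≤∧≢⇒< 1≤p (p≢1 ∘ sym)

χ≤n : ∀ {n} (y : Vec ℕ n) → χ y ≤ n
χ≤n y = max≤v⁺ z≤n (ListAll.map⁺ (ListAll.universal (count≤n _) (PAinv-list y)))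

deg≤χ : ∀ {n} (y : Vec ℕ n) {x} → PAinv y x → deg x ≤ χ y
deg≤χ y px = ListAll.lookup (xs≤max 0 (List.map deg (PAinv-list y)))
  (∈-map⁺ deg (Equivalence.from (∈-PAinv-list {y = y}) px))

-- Subset sums of the car lengths

-- Equal sums of different subsets are listed repeatedly, which makes the length exactly 2 ^ n.
subsetSums : ∀ {n} → Vec ℕ n → List ℕ
subsetSums []      = 0 ∷ []
subsetSums (ℓ ∷ y) = subsetSums y ++ List.map (ℓ +_) (subsetSums y)

length-subsetSums : ∀ {n} (y : Vec ℕ n) → length (subsetSums y) ≡ 2 ^ n
length-subsetSums []      = refl
length-subsetSums {suc n} (ℓ ∷ y) = begin
  length (subsetSums y ++ List.map (ℓ +_) (subsetSums y))
    ≡⟨ length-++ (subsetSums y) ⟩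
  length (subsetSums y) + length (List.map (ℓ +_) (subsetSums y))
    ≡⟨ cong (length (subsetSums y) +_) (length-map (ℓ +_) (subsetSums y)) ⟩
  length (subsetSums y) + length (subsetSums y)
    ≡⟨ cong₂ _+_ (length-subsetSums y) (trans (length-subsetSums y) (sym (+-identityʳ (2 ^ n)))) ⟩
  2 ^ suc n ∎
  where open ≡-Reasoning

∣_∣≤ : List ℕ → ℕ → ℕ
∣ occ ∣≤ v = length (filter (_≤? v) occ)

full-∣∣≤ : ∀ {m occ v} → Packed m occ 0 → v ≤ m → ∣ occ ∣≤ v ≡ v
full-∣∣≤ {m} {occ} {v} pk v≤m = ≤-antisym
  (≤-trans (Unique⇒length≤ (Unique.filter⁺ (_≤? v) (unique pk)) ⊆-range)
           (≤-reflexive (length-range v)))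
  (≤-trans (≤-reflexive (sym (length-range v)))
           (Unique⇒length≤ (range-unique v) range-⊆))
  where
  ⊆-range : filter (_≤? v) occ ⊆ range v
  ⊆-range t∈ with t∈occ , t≤v ← ∈-filter⁻ (_≤? v) {xs = occ} t∈ =
    ∈-range⁺ (proj₁ (ListAll.lookup (inRange pk) t∈occ) , t≤v)

  range-⊆ : range v ⊆ filter (_≤? v) occ
  range-⊆ t∈ with 1≤t , t≤v ← ∈-range⁻ t∈ =
    ∈-filter⁺ (_≤? v) (Packed-full pk (1≤t , ≤-trans t≤v v≤m)) t≤v

-- No car straddles the occupied spot suc v, so each adds its length or 0 to
-- the number of occupied spots up to v.
gap∈subsetSums : ∀ {n m occ v} {y x : Vec ℕ n} → AllPark m occ y x → All (1 ≤_) x →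
                 Packed m occ (sum y) → suc v ∈ occ →
                 ∃[ σ ] σ ∈ subsetSums y × ∣ occ ∣≤ v + σ ≡ v
gap∈subsetSums {y = []} {[]} _ _ pk v∈ =
  0 , here refl ,
  trans (+-identityʳ _) (full-∣∣≤ pk (<⇒≤ (proj₂ (ListAll.lookup (inRange pk) v∈))))
gap∈subsetSums {occ = occ} {v} {ℓ ∷ y} {_ ∷ _} (s , (p≤s , fits , _) , park) (1≤p ∷ 1≤x) pk v∈
  with σ , σ∈ , eq ← gap∈subsetSums park 1≤x (Packed-park pk (≤-trans 1≤p p≤s) fits)
                       (∈-++⁺ʳ (spots s ℓ) v∈)
  with s ≤? v
... | yes s≤v = ℓ + σ , ∈-++⁺ʳ (subsetSums y) (∈-map⁺ (ℓ +_) σ∈) , (begin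
    ∣ occ ∣≤ v + (ℓ + σ)                ≡⟨ +-assoc (∣ occ ∣≤ v) ℓ σ ⟨
    ∣ occ ∣≤ v + ℓ + σ                  ≡⟨ cong (_+ σ) (+-comm (∣ occ ∣≤ v) ℓ) ⟩
    ℓ + ∣ occ ∣≤ v + σ                  ≡⟨ cong (λ a → a + ∣ occ ∣≤ v + σ) all-below ⟨
    ∣ spots s ℓ ∣≤ v + ∣ occ ∣≤ v + σ   ≡⟨ cong (_+ σ) split ⟨
    ∣ spots s ℓ ++ occ ∣≤ v + σ         ≡⟨ eq ⟩
    v                                   ∎)
  where
  open ≡-Reasoning
  split : ∣ spots s ℓ ++ occ ∣≤ v ≡ ∣ spots s ℓ ∣≤ v + ∣ occ ∣≤ v
  split = trans (cong length (filter-++ (_≤? v) (spots s ℓ) occ)) (length-++ (filter (_≤? v) (spots s ℓ)))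

  below : ∀ {t} → t ∈ spots s ℓ → t ≤ v
  below {t} t∈ with t ≤? v
  ... | yes t≤v = t≤v
  ... | no  t≰v = contradiction v∈ (ListAll.lookup (proj₂ fits)
                    (∈-spots⁺ s ℓ (m≤n⇒m≤1+n s≤v) (≤-<-trans (≰⇒> t≰v) (proj₂ (∈-spots⁻ s ℓ t∈)))))

  all-below : ∣ spots s ℓ ∣≤ v ≡ ℓ
  all-below = trans (cong length (filter-all (_≤? v) (ListAll.tabulate below))) (length-spots s ℓ)
... | no  s≰v = σ , ∈-++⁺ˡ σ∈ , trans (cong (λ l → length l + σ) (sym none-below)) eq
  where
  none-below : filter (_≤? v) (spots s ℓ ++ occ) ≡ filter (_≤? v) occ
  none-below = trans (filter-++ (_≤? v) (spots s ℓ) occ) (cong (_++ filter (_≤? v) occ)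
    (filter-none (_≤? v) (ListAll.tabulate λ t∈ t≤v → s≰v (≤-trans (proj₁ (∈-spots⁻ s ℓ t∈)) t≤v))))

PA⇒subsetSum : ∀ {k ℓ w} {y z : Vec ℕ k} → 1 ≤ ℓ → PA (ℓ ∷ y) (w ∷ z) →
               w ∈ List.map suc (subsetSums y)
PA⇒subsetSum {ℓ = ℓ} {suc v} {y} {z} 1≤ℓ
  ((_ , _) ∷ z-ok , s , (w≤s , fits@(s+ℓ≤ , _) , least) , park) with suc v ≟ s
-- On an empty street `w` fits whenever a later `s` does, so the first car gets its preference.
... | no w≢s = contradiction (≤-trans (+-monoˡ-≤ ℓ w≤s) s+ℓ≤ , ListAll.tabulate (λ _ ()))
                             (least (≤∧≢⇒< w≤s w≢s) ≤-refl)
... | yes refl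
  with σ , σ∈ , eq ← gap∈subsetSums park (All.map proj₁ z-ok)
                       (Packed-park Packed-[] (s≤s z≤n) fits) (∈-++⁺ˡ (start∈spots (suc v) 1≤ℓ))
  = ∈-map⁺ suc (subst (_∈ subsetSums y) σ≡v σ∈)
  where
  -- Only the first car has parked, and all its spots lie above `v`, so the count in `eq` is 0.
  σ≡v : σ ≡ v
  σ≡v = trans (cong (λ l → length l + σ) (sym (filter-none (_≤? v) {xs = spots (suc v) ℓ ++ []}
    (ListAll.++⁺ (ListAll.tabulate λ t∈ t≤v → <⇒≱ (proj₁ (∈-spots⁻ (suc v) ℓ t∈)) t≤v) ListAll.[])))) eq

-- Multisets and their number

-- Each multiset is written in the order of `vs`: either `v` is taken and stays available, or it is
-- discarded for good.
multisets : List ℕ → (k : ℕ) → List (Vec ℕ k)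
multisets _        zero    = [] ∷ []
multisets []       (suc k) = []
multisets (v ∷ vs) (suc k) = List.map (v ∷_) (multisets (v ∷ vs) k) ++ multisets vs (suc k)

-- Stars and bars: the two branches of the recursion follow Pascal's rule.
length-multisets : ∀ vs k → length (multisets vs k) ≡ (length vs + k ∸ 1) C k
length-multisets vs       zero    = refl
length-multisets []       (suc k) = sym (k>n⇒nCk≡0 (n<1+n k))
length-multisets (v ∷ vs) (suc k) = begin
  length (List.map (v ∷_) (multisets (v ∷ vs) k) ++ multisets vs (suc k))
    ≡⟨ length-++ (List.map (v ∷_) (multisets (v ∷ vs) k)) ⟩
  length (List.map (v ∷_) (multisets (v ∷ vs) k)) + length (multisets vs (suc k))
    ≡⟨ cong₂ _+_ (trans (length-map (v ∷_) (multisets (v ∷ vs) k)) (length-multisets (v ∷ vs) k))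
                 (length-multisets vs (suc k)) ⟩
  (N + k) C k + (N + suc k ∸ 1) C suc k
    ≡⟨ cong (λ a → (N + k) C k + (a ∸ 1) C suc k) (+-suc N k) ⟩
  (N + k) C k + (N + k) C suc k
    ≡⟨ nCk+nC[k+1]≡[n+1]C[k+1] (N + k) k ⟩
  suc (N + k) C suc k
    ≡⟨ cong (_C suc k) (+-suc N k) ⟨
  (N + suc k) C suc k ∎
  where
  open ≡-Reasoning
  N = length vs

All-∈-drop : ∀ {n v p vs} {x : Vec ℕ n} → v < p → All (p ≤_) x → All (_∈ v ∷ vs) x → All (_∈ vs) x
All-∈-drop _   []          []              = []
All-∈-drop v<p (p≤v ∷ _)   (here refl ∷ _) = contradiction v<p (≤⇒≯ p≤v)
All-∈-drop v<p (_ ∷ p≤x)   (there q∈ ∷ x∈) = q∈ ∷ All-∈-drop v<p p≤x x∈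

-- As `vs` is sorted, `v` is at most `p`. If it is smaller, it occurs nowhere in the vector and is
-- discarded; if equal, it is taken.
∈-multisets : ∀ {vs k} {x : Vec ℕ k} → ListPairs.AllPairs _≤_ vs → Sorted x →
              All (_∈ vs) x → x ∈ multisets vs k
∈-multisets {x = []} _ _ _ = here refl
∈-multisets {v ∷ vs} {suc k} {p ∷ x} vs-sorted@(v≤vs ListPairs.∷ vs-sorted′)
  x-sorted@(p≤x ∷ x-sorted′) x∈@(p∈ ∷ x∈′) =
  [ (λ v<p → ∈-++⁺ʳ (List.map (v ∷_) (multisets (v ∷ vs) k))
      (∈-multisets {vs} {suc k} {p ∷ x} vs-sorted′ x-sorted (All-∈-drop v<p (≤-refl ∷ p≤x) x∈)))
  , (λ v≡p → ∈-++⁺ˡ (subst (λ q → q ∷ x ∈ List.map (v ∷_) (multisets (v ∷ vs) k)) v≡p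
      (∈-map⁺ (v ∷_) (∈-multisets {v ∷ vs} {k} {x} vs-sorted x-sorted′ x∈′))))
  ]′ (m≤n⇒m<n∨m≡n (ListAll.lookup (≤-refl ListAll.∷ v≤vs) p∈))

-- The first entry and the final count

-- Were `p` above 1, spot 1 would have to be occupied before any car arrives.
head≡1 : ∀ {k} {y : Vec ℕ (suc k)} {p x} → PA y (p ∷ x) → Sorted (p ∷ x) → p ≡ 1
head≡1 {p = p} ((1≤p , p≤m) ∷ _ , park) (p≤x ∷ _) with 1 ≟ p
... | yes refl = refl
... | no 1≢p   = contradiction
  (AllPark-occupied park Packed-[] 1≤p (≤-refl ∷ p≤x) (≤-refl , ≤-trans 1≤p p≤m) (≤∧≢⇒< 1≤p 1≢p))
  λ ()

theorem6 : ∀ (k : ℕ) → let n = suc k in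
    (y : Vec ℕ n) → All (1 ≤_) y →
    (∀ x → PAinv↑ y x → Ones×Power (n ∸ χ y) (𝓦 y) (χ y) x)
    × ∣PAinv↑ y ∣ ≤ (2 ^ (n ∸ 1) + n ∸ 2) C (n ∸ 1)
theorem6 k y@(_ ∷ y′) 1≤y@(1≤ℓ ∷ _) =
  (λ x px@(pinv , linked) →
    Sorted⇒Ones×Power (suc k ∸ χ y) (sym (m∸n+n≡m (χ≤n y))) (Linked⇒Sorted linked)
      (All.map proj₁ (proj₁ (proj₁ pinv))) (entries∈𝓦 1≤y px) (deg≤χ y pinv)) ,
  (begin
    ∣PAinv↑ y ∣                                 ≤⟨ Unique⇒length≤ (PAinv↑-list-unique y) ⊆-candidates ⟩
    length (List.map (1 ∷_) (multisets vals k)) ≡⟨ length-map (1 ∷_) (multisets vals k) ⟩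
    length (multisets vals k)                   ≡⟨ length-multisets vals k ⟩
    (length vals + k ∸ 1) C k                   ≡⟨ cong (λ a → (a + k ∸ 1) C k) length-vals ⟩
    (2 ^ k + k ∸ 1) C k                         ≡⟨ cong (λ a → (a ∸ 2) C k) (+-suc (2 ^ k) k) ⟨
    (2 ^ k + suc k ∸ 2) C k                     ∎)
  where
  open ≤-Reasoning

  sums vals : List ℕ
  sums = List.map suc (subsetSums y′)
  -- `∈-multisets` needs a sorted list; repeated values are kept, since only the length enters the
  -- count.
  vals = sort sums

  length-vals : length vals ≡ 2 ^ k
  length-vals = trans (↭-length (sort-↭ sums))
    (trans (length-map suc (subsetSums y′)) (length-subsetSums y′))

  entry∈vals : ∀ {x w} → PAinv↑ y x → w ∈ toList x → w ∈ vals
  -- The arrangement (w, 1, ..., 1) is the one that puts `w` on the first car.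
  entry∈vals px w∈ = ∈-resp-↭ (↭-sym (sort-↭ sums))
    (PA⇒subsetSum 1≤ℓ (OnesBut⇒PA 1≤y px w∈ (this {z = replicate k 1} (All.lookup⁻ λ i → lookup-replicate i 1))))

  ⊆-candidates : PAinv↑-list y ⊆ List.map (1 ∷_) (multisets vals k)
  ⊆-candidates {p ∷ x} x∈ with px@((pa , _) , linked) ← Equivalence.to (∈-PAinv↑-list {y = y}) x∈
    with sorted@(_ ∷ x-sorted) ← Linked⇒Sorted linked
    with refl ← head≡1 pa sorted =
    ∈-map⁺ (1 ∷_) (∈-multisets (Linked⇒AllPairs ≤-trans (sort-↗ sums)) x-sorted
      (All.toList⁻ (ListAll.tabulate (entry∈vals px ∘ there))))
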